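{- Let $G$ be an HZ-graph with maximum degree $\Delta\ge 4$. Then for any two adjacent vertices $x,y\in V_{\Delta-1}$, $N_\Delta(x)=N_\Delta(y)$.
   Context: All graphs are simple. An HZ-graph is a connected graph $G$ of class 2 (i.e. $\chi'(G)=\Delta+1$ where $\Delta$ is the maximum degree of $G$) such that the core $G_\Delta$ (the subgraph induced by the vertices of degree $\Delta$) has maximum degree at most 2. $V_i$ denotes the set of vertices of degree $i$ in $G$, and $N_i(v)=N_G(v)\cap V_i$. -}

module Defs where

open import Data.Nat using (ℕ; zero; suc; _≤_; _≡ᵇ_)
open import Data.Fin using (Fin)
open import Data.Bool using (Bool; true; false; _∧_; _≟_)
open import Data.List using (List; []; _∷_; length; filter; allFin)
open import Data.Product using (Σ; _×_; ∃; ∃-syntax)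
open import Relation.Binary.PropositionalEquality using (_≡_; _≢_)
open import Relation.Nullary using (¬_)
open import Function.Bundles using (_⇔_)

record Graph (n : ℕ) : Set where
  field
    adj     : Fin n → Fin n → Bool
    sym     : ∀ u v → adj u v ≡ adj v u
    irrefl  : ∀ v → adj v v ≡ false
open Graph public

Adj : {n : ℕ} → Graph n → Fin n → Fin n → Set
Adj G u v = adj G u v ≡ true

countB : {n : ℕ} → (Fin n → Bool) → ℕ
countB {n} p = length (filter (λ u → p u ≟ true) (allFin n))

deg : {n : ℕ} → Graph n → Fin n → ℕ
deg G v = countB (adj G v)

IsMaxDegree : {n : ℕ} → Graph n → ℕ → Set
IsMaxDegree {n} G Δ = (∀ v → deg G v ≤ Δ) × (∃[ v ] deg G v ≡ Δ)

data Walk {n : ℕ} (G : Graph n) : Fin n → Fin n → Set where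
  here : ∀ {u} → Walk G u u
  step : ∀ {u w v} → Adj G u w → Walk G w v → Walk G u v

Connected : {n : ℕ} → Graph n → Set
Connected G = ∀ u v → Walk G u v

-- a proper edge colouring with k colours: a colour for each (unordered) edge
-- (given as a symmetric function on pairs, only its values on edges matter),
-- such that edges sharing an endpoint get different colours
record ProperEdgeColouring {n : ℕ} (G : Graph n) (k : ℕ) : Set where
  field
    colour  : Fin n → Fin n → Fin k
    csym    : ∀ u v → colour u v ≡ colour v u
    proper  : ∀ u v w → Adj G u v → Adj G u w → v ≢ w → colour u v ≢ colour u w

EdgeColourable : {n : ℕ} → Graph n → ℕ → Set
EdgeColourable G k = ProperEdgeColouring G k

ChromaticIndex : {n : ℕ} → Graph n → ℕ → Set
ChromaticIndex G k = EdgeColourable G k × (∀ j → EdgeColourable G j → k ≤ j)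

Class2 : {n : ℕ} → Graph n → ℕ → Set
Class2 G Δ = IsMaxDegree G Δ × ChromaticIndex G (suc Δ)

degΔNbrs : {n : ℕ} → Graph n → ℕ → Fin n → ℕ
degΔNbrs G Δ v = countB (λ u → adj G v u ∧ (deg G u ≡ᵇ Δ))

-- HZ-graph with maximum degree Δ: connected, class 2, and the core
-- G_Δ (induced by degree-Δ vertices) has maximum degree ≤ 2
IsHZGraph : {n : ℕ} → Graph n → ℕ → Set
IsHZGraph {n} G Δ =
  Connected G × Class2 G Δ × (∀ v → deg G v ≡ Δ → degΔNbrs G Δ v ≤ 2)

InNΔ : {n : ℕ} → Graph n → ℕ → Fin n → Fin n → Set
InNΔ G Δ x u = Adj G x u × deg G u ≡ Δ

{-# OPTIONS --safe #-}

-- Let r be a vertex of degree Δ adjacent to x but not to y. The graph is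
-- Δ-critical by Vizing's adjacency lemma, so G - rx has a Δ-edge-colouring. In every such colouring
-- r and x have no missing colour in common, and Vizing's fan argument at r uses nothing else about x:
-- the sequences of colours at r started from distinct missing colours of such vertices are disjoint,
-- and each leads to its own neighbour of r of degree Δ. The key point is that y, though not adjacent
-- to r, also never shares a missing colour with r. Then two colours missing at x and one missing at y
-- give three neighbours of r of degree Δ, while the core has maximum degree at most 2.
module Submission where

open import Defs
open import Data.Nat using (ℕ; zero; suc; _+_; _≤_; _<_; _∸_; _≡ᵇ_; z≤n; s≤s)
open import Data.Nat.Properties as ℕ using ()
open import Data.Nat.Induction using (Acc; acc; <-wellFounded)
open import Data.Fin using (Fin; zero; suc; _≟_; fromℕ<)
open import Data.Fin.Properties using (any?; injective⇒≤)
open import Data.Fin.Permutation.Components using (transpose)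
open import Data.Bool as Bool using (Bool; true; false; not; _∧_)
open import Data.Bool.Properties using (T-≡; ¬-not)
open import Data.List using (cartesianProduct; List; []; _∷_; _++_; length; map; filter; allFin; lookup)
open import Data.List.Properties using (length-++; length-map; length-tabulate)
open import Data.List.Membership.Propositional using (_∈_; _∉_)
open import Data.List.Membership.Propositional.Properties
  using (∈-lookup; ∈-allFin; ∈-filter⁺; ∈-filter⁻; ∈-map⁺; ∈-++⁺ˡ; ∈-++⁺ʳ; ∈-cartesianProduct⁺)
open import Data.List.Relation.Unary.Any using (here; there; index)
open import Data.List.Relation.Unary.Any.Properties using (lookup-index)
open import Data.List.Relation.Unary.All as All using (All; []; _∷_)
open import Data.List.Relation.Unary.AllPairs using ([]; _∷_)
open import Data.List.Relation.Unary.Unique.Propositional using (Unique)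
open import Data.List.Relation.Unary.Unique.Propositional.Properties using (allFin⁺; filter⁺)
open import Data.Product using (_×_; _,_; proj₁; proj₂; ∃; ∃-syntax; ∃₂)
open import Data.Sum using (_⊎_; inj₁; inj₂; [_,_]′; swap)
open import Data.Sum.Properties using (inj₁-injective; inj₂-injective)
open import Data.Empty using (⊥; ⊥-elim)
open import Function using (_∘_; case_of_)
open import Function.Bundles using (_⇔_; mk⇔; Equivalence)
open import Relation.Nullary using (¬_; Dec; yes; no; does; contradiction)
open import Relation.Nullary.Decidable
  using (_×-dec_; _⊎-dec_; dec-true; dec-false; does-⇔; decidable-stable; ¬¬-excluded-middle)
open import Relation.Binary.PropositionalEquality
  using (_≡_; _≢_; refl; trans; cong; cong₂; subst) renaming (sym to ≡-sym)

-- The claim about `y` cannot be settled within one colouring. If `r` and `y` both miss `ρ`, the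
-- missing colours `a` and `b` of `x` give only two full neighbours of `r`. The third has to come
-- from the colour `c` of the edge `xy`, which `x` misses only after that edge is recoloured. The
-- three ends are thus found in different colourings, and comparing them requires that paths survive
-- Kempe changes. Membership in a Kempe chain is never decided. Chains enter through Boolean sets
-- closed under two colours, and an argument that needs one particular chain runs under a double
-- negation, which is harmless because the conclusions are negations or decidable.

lookup-injective : {A : Set} {xs : List A} → Unique xs →
  ∀ {i j} → lookup xs i ≡ lookup xs j → i ≡ j
lookup-injective (_ ∷ _) {zero} {zero} _ = refl
lookup-injective (x∉ ∷ _) {zero} {suc j} eq =
  contradiction eq (All.lookup x∉ (∈-lookup j))
lookup-injective (x∉ ∷ _) {suc i} {zero} eq =
  contradiction (≡-sym eq) (All.lookup x∉ (∈-lookup i))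
lookup-injective (_ ∷ u) {suc i} {suc j} eq = cong suc (lookup-injective u eq)

injection⇒length≤ : {A B : Set} (f : A → B) {xs : List A} {ys : List B} → Unique xs →
  (∀ {a a′} → a ∈ xs → a′ ∈ xs → f a ≡ f a′ → a ≡ a′) →
  (∀ {a} → a ∈ xs → f a ∈ ys) → length xs ≤ length ys
injection⇒length≤ f {xs} {ys} uniq inj into =
  injective⇒≤ {f = λ i → index (into (∈-lookup {xs = xs} i))} λ {i} {j} eq →
    lookup-injective uniq (inj (∈-lookup i) (∈-lookup j)
      (trans (lookup-index (into (∈-lookup i)))
        (trans (cong (lookup ys) eq) (≡-sym (lookup-index (into (∈-lookup j)))))))

-- Finitely many instances of excluded middle hold together under a double negation; this yields the
-- Boolean indicator of a Kempe chain.
¬¬-Π-Dec : ∀ {n} (P : Fin n → Set) → ¬ ¬ (∀ v → Dec (P v))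
¬¬-Π-Dec {zero} P k = k λ ()
¬¬-Π-Dec {suc n} P k = ¬¬-excluded-middle λ p₀ → ¬¬-Π-Dec (P ∘ suc) λ ps →
  k λ { zero → p₀ ; (suc v) → ps v }

-- Alternating orbits of two involutions

module AlternatingOrbit {V : Set} (f g : V → V)
  (f-inv : ∀ v → f (f v) ≡ v) (g-inv : ∀ v → g (g v) ≡ v)
  {w : V} (gw≡w : g w ≡ w) where

  h : ℕ → V → V
  h 0 = f
  h 1 = g
  h (suc (suc i)) = h i

  z : ℕ → V
  z zero = w
  z (suc i) = h i (z i)

  h-inv : ∀ i v → h i (h i v) ≡ v
  h-inv 0 = f-inv
  h-inv 1 = g-inv
  h-inv (suc (suc i)) = h-inv i

  h-parity : ∀ i j → h i ≡ h j ⊎ h i ≡ h (suc j)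
  h-parity 0 0 = inj₁ refl
  h-parity 0 1 = inj₂ refl
  h-parity 1 0 = inj₂ refl
  h-parity 1 1 = inj₁ refl
  h-parity (suc (suc i)) j = h-parity i j
  h-parity 0 (suc (suc j)) = h-parity 0 j
  h-parity 1 (suc (suc j)) = h-parity 1 j

  InOrbit : V → Set
  InOrbit v = ∃[ i ] z i ≡ v

  -- Either `h i` is the involution applied next, or it undoes the last one; at `w` there is nothing
  -- to undo, because `g` fixes `w`.
  orbit-h : ∀ i {v} → InOrbit v → InOrbit (h i v)
  orbit-h i (j , refl) with h-parity i j
  ... | inj₁ eq rewrite eq = suc j , refl
  orbit-h i (zero , refl) | inj₂ eq rewrite eq = 0 , ≡-sym gw≡w
  orbit-h i (suc j , refl) | inj₂ eq rewrite eq = j , ≡-sym (h-inv j (z j))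

  InInitial : ℕ → V → Set
  InInitial p v = ∃[ j ] j ≤ p × z j ≡ v

  -- The stall closes the far end of the segment just as `gw≡w` closes the near end.
  initial-closed : ∀ {p} → h p (z p) ≡ z p → ∀ i {v} → InInitial p v → InInitial p (h i v)
  initial-closed {p} stall i (j , j≤p , refl) with h-parity i j
  ... | inj₁ eq rewrite eq with ℕ.m≤n⇒m<n∨m≡n j≤p
  ...   | inj₁ j<p = suc j , j<p , refl
  ...   | inj₂ refl = p , ℕ.≤-refl , ≡-sym stall
  initial-closed stall i (zero , j≤p , refl) | inj₂ eq rewrite eq = 0 , z≤n , ≡-sym gw≡w
  initial-closed stall i (suc j , j≤p , refl) | inj₂ eq rewrite eq =
    j , ℕ.<⇒≤ j≤p , ≡-sym (h-inv j (z j))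

  orbit⊆initial : ∀ {p} → h p (z p) ≡ z p → ∀ q → InInitial p (z q)
  orbit⊆initial stall zero = 0 , z≤n , refl
  orbit⊆initial stall (suc q) = initial-closed stall q (orbit⊆initial stall q)

  End : V → Set
  End v = f v ≡ v ⊎ g v ≡ v

  -- The involution fixing `z p` is either the next one, a stall at `p`, or the one that led to
  -- `z p`; in that case `z` already stalled one index earlier.
  end⇒stall : ∀ p → z p ≢ w → End (z p) → ∃[ q ] q ≤ p × z q ≡ z p × h q (z q) ≡ z q
  end⇒stall p zp≢w end = fixed-by (by-h end)
    where
    by-h : End (z p) → h p (z p) ≡ z p ⊎ h (suc p) (z p) ≡ z p
    by-h (inj₁ e) with h-parity 0 p
    ... | inj₁ eq = inj₁ (trans (cong (λ k → k (z p)) (≡-sym eq)) e)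
    ... | inj₂ eq = inj₂ (trans (cong (λ k → k (z p)) (≡-sym eq)) e)
    by-h (inj₂ e) with h-parity 1 p
    ... | inj₁ eq = inj₁ (trans (cong (λ k → k (z p)) (≡-sym eq)) e)
    ... | inj₂ eq = inj₂ (trans (cong (λ k → k (z p)) (≡-sym eq)) e)
    fixed-by : h p (z p) ≡ z p ⊎ h (suc p) (z p) ≡ z p →
               ∃[ q ] q ≤ p × z q ≡ z p × h q (z q) ≡ z q
    fixed-by (inj₁ e) = p , ℕ.≤-refl , refl , e
    fixed-by (inj₂ e) = back p zp≢w e
      where
      back : ∀ p → z p ≢ w → h (suc p) (z p) ≡ z p →
             ∃[ q ] q ≤ p × z q ≡ z p × h q (z q) ≡ z q
      back zero ≢w _ = contradiction refl ≢w
      back (suc q) _ e = q , ℕ.n≤1+n q , same , ≡-sym same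
        where same = trans (≡-sym (h-inv q (z q))) e

  -- An orbit that stalls at index p is contained in z 0 … z p, so a second end stalls earlier:
  -- two ends other than w would descend forever.
  no-two-stalls : ∀ {p} → Acc _<_ p → ∀ {u v} → u ≢ w → v ≢ w → u ≢ v → End u → End v →
    z p ≡ u → h p (z p) ≡ z p → InOrbit v → ⊥
  no-two-stalls {p} (acc rec) u≢w v≢w u≢v u-end v-end refl stall (i , refl)
    with orbit⊆initial stall i
  ... | j , j≤p , zj≡v
    with end⇒stall j (v≢w ∘ trans (≡-sym zj≡v)) (subst End (≡-sym zj≡v) v-end)
  ...   | q , q≤j , zq≡zj , q-stall =
      no-two-stalls (rec q<p) v≢w u≢w (u≢v ∘ ≡-sym) v-end u-end zq≡v q-stall (p , refl)
    where
    zq≡v = trans zq≡zj zj≡v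
    q<p : q < p
    q<p = ℕ.≤∧≢⇒< (ℕ.≤-trans q≤j j≤p) λ { refl → u≢v zq≡v }

  at-most-one-other-end : ∀ {u v} → u ≢ w → v ≢ w → u ≢ v → End u → End v →
    InOrbit u → InOrbit v → ⊥
  at-most-one-other-end u≢w v≢w u≢v u-end v-end (p , refl) v∈
    with end⇒stall p u≢w u-end
  ... | q , _ , zq≡u , stall =
    no-two-stalls (<-wellFounded q) u≢w v≢w u≢v u-end v-end zq≡u stall v∈

-- Edge colourings and Kempe changes

-- A proper edge colouring, with each colour class α encoded as the involution σ α whose
-- 2-cycles are the edges coloured α; its fixed points are the vertices missing α.
record Colouring {n : ℕ} (E : Graph n) (k : ℕ) : Set where
  field
    σ           : Fin k → Fin n → Fin n
    involutive  : ∀ α v → σ α (σ α v) ≡ v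
    edge        : ∀ α v → σ α v ≢ v → Adj E v (σ α v)
    cover       : ∀ u v → Adj E u v → ∃[ α ] σ α u ≡ v
    unique      : ∀ α β v → σ α v ≡ σ β v → σ α v ≢ v → α ≡ β
open Colouring

adj⇒≢ : ∀ {n} (E : Graph n) {u v} → Adj E u v → u ≢ v
adj⇒≢ E {u} a refl with trans (≡-sym a) (irrefl E u)
... | ()

adj-sym : ∀ {n} (E : Graph n) {u v} → Adj E u v → Adj E v u
adj-sym E {u} {v} = trans (Graph.sym E v u)

transpose-involutive : ∀ {k} (α β : Fin k) γ → transpose α β (transpose α β γ) ≡ γ
transpose-involutive α β γ with γ ≟ α
transpose-involutive α β γ | yes refl with β ≟ α
... | yes refl = refl
... | no _ rewrite dec-true (β ≟ β) refl = refl
transpose-involutive α β γ | no γ≢α with γ ≟ β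
... | yes refl rewrite dec-true (α ≟ α) refl = refl
... | no γ≢β rewrite dec-false (γ ≟ α) γ≢α | dec-false (γ ≟ β) γ≢β = refl

recolour : ∀ {k} → Bool → Fin k → Fin k → Fin k → Fin k
recolour false α β γ = γ
recolour true  α β γ = transpose α β γ

recolour-involutive : ∀ {k} b (α β γ : Fin k) → recolour b α β (recolour b α β γ) ≡ γ
recolour-involutive false α β γ = refl
recolour-involutive true  α β γ = transpose-involutive α β γ

recolour-other : ∀ {k} b {α β γ : Fin k} → γ ≢ α → γ ≢ β → recolour b α β γ ≡ γ
recolour-other false _ _ = refl
recolour-other true {α} {β} {γ} γ≢α γ≢β
  rewrite dec-false (γ ≟ α) γ≢α | dec-false (γ ≟ β) γ≢β = refl

recolour-α : ∀ {k} (α β : Fin k) → recolour true α β α ≡ β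
recolour-α α β rewrite dec-true (α ≟ α) refl = refl

recolour-β : ∀ {k} (α β : Fin k) → recolour true α β β ≡ α
recolour-β α β with β ≟ α
... | yes refl = refl
... | no _ rewrite dec-true (β ≟ β) refl = refl

pair : ∀ {n} → Fin n → Fin n → Fin n → Bool
pair u w v = does (v ≟ u ⊎-dec v ≟ w)

pair-left : ∀ {n} (u w : Fin n) → pair u w u ≡ true
pair-left u w = dec-true (u ≟ u ⊎-dec u ≟ w) (inj₁ refl)

pair-right : ∀ {n} (u w : Fin n) → pair u w w ≡ true
pair-right u w = dec-true (w ≟ u ⊎-dec w ≟ w) (inj₂ refl)

pair-out : ∀ {n} {u w v : Fin n} → v ≢ u → v ≢ w → pair u w v ≡ false
pair-out {u = u} {w} {v} v≢u v≢w = dec-false (v ≟ u ⊎-dec v ≟ w) [ v≢u , v≢w ]′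

module _ {n k : ℕ} {E : Graph n} where

  Miss : Colouring E k → Fin n → Fin k → Set
  Miss φ v α = σ φ α v ≡ v

  σ-swap : ∀ (φ : Colouring E k) {α u v} → σ φ α u ≡ v → σ φ α v ≡ u
  σ-swap φ {α} {u} refl = involutive φ α u

  -- `χ` indicates a union of Kempe chains in the colours `α` and `β`.
  Closed : Colouring E k → Fin k → Fin k → (Fin n → Bool) → Set
  Closed φ α β χ = ∀ v → χ (σ φ α v) ≡ χ v × χ (σ φ β v) ≡ χ v

  closed-comm : ∀ {φ α β χ} → Closed φ α β χ → Closed φ β α χ
  closed-comm cl v = proj₂ (cl v) , proj₁ (cl v)

  -- Both ends of an edge coloured `α` or `β` carry the same flag, so they agree on its new colour.
  -- This makes the classes of `kempe` involutions again.
  recolour-closed : ∀ φ {α β χ} → Closed φ α β χ → ∀ γ v →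
    recolour (χ (σ φ (recolour (χ v) α β γ) v)) α β γ ≡ recolour (χ v) α β γ
  recolour-closed φ {α} {β} {χ} cl γ v with γ ≟ α | γ ≟ β
  ... | no γ≢α | no γ≢β =
    trans (recolour-other (χ (σ φ (recolour (χ v) α β γ) v)) γ≢α γ≢β) (≡-sym (recolour-other (χ v) γ≢α γ≢β))
  ... | yes refl | _ = cong (λ b → recolour b α β α) (same (χ v))
    where
    same : ∀ b → χ (σ φ (recolour b α β α) v) ≡ χ v
    same false = proj₁ (cl v)
    same true rewrite recolour-α α β = proj₂ (cl v)
  ... | no _ | yes refl = cong (λ b → recolour b α β β) (same (χ v))
    where
    same : ∀ b → χ (σ φ (recolour b α β β) v) ≡ χ v
    same false = proj₂ (cl v)
    same true rewrite recolour-β α β = proj₁ (cl v)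

  kempe : ∀ φ {α β χ} → Closed φ α β χ → Colouring E k
  kempe φ {α} {β} {χ} cl = record
    { σ = λ γ v → σ φ (r v γ) v
    ; involutive = λ γ v →
        trans (cong (λ δ → σ φ δ (σ φ (r v γ) v)) (recolour-closed φ cl γ v))
          (involutive φ (r v γ) v)
    ; edge = λ γ v → edge φ (r v γ) v
    ; cover = λ u v a → let (γ , eq) = cover φ u v a in
        r u γ , trans (cong (λ δ → σ φ δ u) (recolour-involutive (χ u) α β γ)) eq
    ; unique = λ γ δ v eq ne →
        trans (≡-sym (recolour-involutive (χ v) α β γ))
          (trans (cong (r v) (unique φ (r v γ) (r v δ) v eq ne))
            (recolour-involutive (χ v) α β δ))
    }
    where r = λ v → recolour (χ v) α β

  module _ (φ : Colouring E k) {α β : Fin k} {χ : Fin n → Bool} (cl : Closed φ α β χ) where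

    kempe-off : ∀ {v} → χ v ≡ false → ∀ γ → σ (kempe φ cl) γ v ≡ σ φ γ v
    kempe-off eq γ rewrite eq = refl

    kempe-other : ∀ {γ} → γ ≢ α → γ ≢ β → ∀ v → σ (kempe φ cl) γ v ≡ σ φ γ v
    kempe-other γ≢α γ≢β v = cong (λ δ → σ φ δ v) (recolour-other (χ v) γ≢α γ≢β)

    kempe-α : ∀ {v} → χ v ≡ true → σ (kempe φ cl) α v ≡ σ φ β v
    kempe-α {v} eq rewrite eq = cong (λ δ → σ φ δ v) (recolour-α α β)

    kempe-β : ∀ {v} → χ v ≡ true → σ (kempe φ cl) β v ≡ σ φ α v
    kempe-β {v} eq rewrite eq = cong (λ δ → σ φ δ v) (recolour-β α β)

  -- The vertices lie on one chain, expressed as: no closed set separates them.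
  Linked : Colouring E k → Fin k → Fin k → Fin n → Fin n → Set
  Linked φ α β u v = ∀ χ → Closed φ α β χ → χ u ≡ χ v

  -- Complements of closed sets are closed, so only one way of separating has to be refuted.
  linked : ∀ {φ α β u v} →
    (∀ χ → Closed φ α β χ → χ u ≡ true → χ v ≡ false → ⊥) → Linked φ α β u v
  linked {u = u} {v} sep χ cl with χ u in eu | χ v in ev
  ... | true | true = refl
  ... | false | false = refl
  ... | true | false = ⊥-elim (sep χ cl eu ev)
  ... | false | true = ⊥-elim (sep (not ∘ χ)
    (λ t → cong not (proj₁ (cl t)) , cong not (proj₂ (cl t))) (cong not eu) (cong not ev))

  End : Colouring E k → Fin k → Fin k → Fin n → Set
  End φ α β v = Miss φ v α ⊎ Miss φ v β

  private
    separate-β : ∀ φ {α β u v w} → End φ α β u → End φ α β v → Miss φ w β →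
      u ≢ v → u ≢ w → v ≢ w → Linked φ α β u v →
      (∀ χ → Closed φ α β χ → χ w ≡ true → χ u ≡ false → χ v ≡ false → ⊥) → ⊥
    separate-β φ {α} {β} {u} {v} {w} u-end v-end w-miss u≢v u≢w v≢w lk κ =
      -- The separating set is the chain of `w`, that is, its orbit under the two involutions.
      ¬¬-Π-Dec InOrbit body
      where
      open AlternatingOrbit (σ φ α) (σ φ β) (involutive φ α) (involutive φ β) w-miss
      body : (∀ t → Dec (InOrbit t)) → ⊥
      body dec = κ χ closed (dec-true (dec w) (0 , refl))
          χu≡false (trans (≡-sym (lk χ closed)) χu≡false)
        where
        χ : Fin n → Bool
        χ t = does (dec t)
        in-orbit : ∀ {t} → χ t ≡ true → InOrbit t
        in-orbit {t} eq with dec t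
        ... | yes p = p
        orbit-back : ∀ i {t} → InOrbit (h i t) → InOrbit t
        orbit-back i {t} p = subst InOrbit (h-inv i t) (orbit-h i p)
        closed : Closed φ α β χ
        closed t = does-⇔ (mk⇔ (orbit-back 0) (orbit-h 0)) (dec (σ φ α t)) (dec t)
                 , does-⇔ (mk⇔ (orbit-back 1) (orbit-h 1)) (dec (σ φ β t)) (dec t)
        χu≡false : χ u ≡ false
        χu≡false = ¬-not λ χu → at-most-one-other-end u≢w v≢w u≢v u-end v-end
          (in-orbit χu) (in-orbit (trans (≡-sym (lk χ closed)) χu))

  -- A Kempe chain has at most two ends, so it separates a third end from two linked ones.
  separate : ∀ φ {α β u v w} → End φ α β u → End φ α β v → End φ α β w →
    u ≢ v → u ≢ w → v ≢ w → Linked φ α β u v →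
    (∀ χ → Closed φ α β χ → χ w ≡ true → χ u ≡ false → χ v ≡ false → ⊥) → ⊥
  separate φ u-end v-end (inj₁ miss) u≢v u≢w v≢w lk κ =
    separate-β φ (swap u-end) (swap v-end) miss u≢v u≢w v≢w
      (λ χ cl → lk χ (closed-comm {φ} cl)) (λ χ cl → κ χ (closed-comm {φ} cl))
  separate φ u-end v-end (inj₂ miss) = separate-β φ u-end v-end miss

  -- An edge coloured `α` whose ends both miss `β` is a whole chain, so a Kempe change can recolour
  -- this edge alone.
  pair-closed : ∀ φ {α β u w} → σ φ α u ≡ w → Miss φ u β → Miss φ w β → Closed φ α β (pair u w)
  pair-closed φ {α} {β} {u} {w} edge-uw miss-u miss-w v = invariant α fα , invariant β fβ
    where
    P : Fin n → Set
    P v = v ≡ u ⊎ v ≡ w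
    invariant : ∀ γ → (∀ {v} → P v → P (σ φ γ v)) → pair u w (σ φ γ v) ≡ pair u w v
    invariant γ f = does-⇔ (mk⇔ (λ p → subst P (involutive φ γ v) (f p)) f)
      (σ φ γ v ≟ u ⊎-dec σ φ γ v ≟ w) (v ≟ u ⊎-dec v ≟ w)
    fα : ∀ {v} → P v → P (σ φ α v)
    fα (inj₁ refl) = inj₂ edge-uw
    fα (inj₂ refl) = inj₁ (σ-swap φ edge-uw)
    fβ : ∀ {v} → P v → P (σ φ β v)
    fβ (inj₁ refl) = inj₁ miss-u
    fβ (inj₂ refl) = inj₂ miss-w

-- Vizing fans

-- Vizing fans at r, seen as sequences of colours: if s misses c, then the c-neighbour of r is next.
-- The list holds the colours of the edges used at r, latest first.
module Fans {n : ℕ} (k : ℕ) (E : Graph n) (r : Fin n) where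

  private
    V = Fin n
    C = Fin k
    M = Colouring E k

  data Path (φ : M) (v₀ : V) (m₀ : C) : List C → V → C → Set where
    start : Miss φ v₀ m₀ → Path φ v₀ m₀ [] v₀ m₀
    step  : ∀ {cs s c t d} → Path φ v₀ m₀ cs s c → c ∉ cs →
            σ φ c r ≡ t → t ≢ r → Miss φ t d → Path φ v₀ m₀ (c ∷ cs) t d

  -- This is all that the fan argument uses about its first vertex. It quantifies over all
  -- colourings because the argument keeps changing the colouring, and it is a separate notion so
  -- that it can be established for `y` too.
  record Exclusive (v₀ : V) : Set where
    field
      ≢r        : v₀ ≢ r
      nonadj    : ¬ Adj E r v₀
      no-common : ∀ (φ : M) {ρ} → Miss φ r ρ → Miss φ v₀ ρ → ⊥
  open Exclusive

  path-miss : ∀ {φ v₀ m₀ cs s d} → Path φ v₀ m₀ cs s d → Miss φ s d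
  path-miss (start m) = m
  path-miss (step _ _ _ _ m) = m

  path-colour : ∀ {φ v₀ m₀ cs s d} → Path φ v₀ m₀ cs s d → ∀ {e} → e ∈ cs → ¬ Miss φ r e
  path-colour (step _ _ refl t≢r _) (here refl) = t≢r
  path-colour (step p _ _ _ _) (there e∈) = path-colour p e∈

  edge-at-r : ∀ (φ : M) {c t} → σ φ c r ≡ t → t ≢ r → Adj E r t
  edge-at-r φ {c} refl t≢r = edge φ c r t≢r

  path-end : ∀ {φ v₀ m₀ cs s d} → Path φ v₀ m₀ cs s d → s ≡ v₀ ⊎ Adj E r s
  path-end (start _) = inj₁ refl
  path-end {φ} (step _ _ eq t≢r _) = inj₂ (edge-at-r φ eq t≢r)

  path-end≢r : ∀ {φ v₀ m₀ cs s d} → Exclusive v₀ → Path φ v₀ m₀ cs s d → s ≢ r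
  path-end≢r X (start _) = ≢r X
  path-end≢r X (step _ _ _ t≢r _) = t≢r

  path-end≢next : ∀ {φ v₀ m₀ cs s d c t} → Exclusive v₀ → Path φ v₀ m₀ cs s d →
    c ∉ cs → σ φ c r ≡ t → t ≢ r → s ≢ t
  path-end≢next {φ} X (start _) _ eq t≢r refl = nonadj X (edge-at-r φ eq t≢r)
  path-end≢next {φ} X (step {c = c′} _ _ refl s≢r _) c∉ eq t≢r s≡t =
    c∉ (here (unique φ _ c′ r (trans eq (≡-sym s≡t)) (subst (_≢ r) (≡-sym eq) t≢r)))

  prefix : ∀ {φ v₀ m₀ cs s d e} → Path φ v₀ m₀ cs s d → e ∈ cs →
    ∃₂ λ cs′ v → Path φ v₀ m₀ cs′ v e × e ∉ cs′ × (∀ {f} → f ∈ cs′ → f ∈ cs)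
  prefix (step p c∉ _ _ _) (here refl) = _ , _ , p , c∉ , there
  prefix (step p _ _ _ _) (there e∈) with prefix p e∈
  ... | cs′ , v , q , e∉ , sub = cs′ , v , q , e∉ , there ∘ sub

  -- `keep` is asked only for prefixes whose last colour is fresh, which is what `end-linked` needs
  -- when `stable` calls on it.
  transport : ∀ {φ φ′ v₀ m₀ cs s d} → Path φ v₀ m₀ cs s d →
    (∀ {e} → e ∈ cs → σ φ′ e r ≡ σ φ e r) →
    (∀ {cs′ v e} → Path φ v₀ m₀ cs′ v e → e ∈ cs → e ∉ cs′ → Miss φ′ v e) →
    Miss φ′ s d → Path φ′ v₀ m₀ cs s d
  transport (start _) _ _ m = start m
  transport (step p c∉ eq t≢r _) same-r keep m =
    step (transport p (same-r ∘ there) (λ q e∈ → keep q (there e∈)) (keep p (here refl) c∉))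
      c∉ (trans (same-r (here refl)) eq) t≢r m

  -- Swapping the edge from r to the last vertex makes r miss the previous colour of the path.
  path-avoids-r : ∀ {v₀ m₀} → Exclusive v₀ → ∀ cs {φ s d} →
    Path φ v₀ m₀ cs s d → ¬ Miss φ r d
  path-avoids-r X [] {φ} (start m) mr = no-common X φ mr m
  path-avoids-r {v₀} {m₀} X (c ∷ cs) {φ} {t} {d} (step {s = s} p c∉ refl t≢r mt) mr =
    path-avoids-r X cs p′ (trans (kempe-α φ cl (pair-left r t)) mr)
    where
    cl : Closed φ c d (pair r t)
    cl = pair-closed φ refl mr mt
    other : ∀ {e} → e ∈ cs → ∀ v → σ (kempe φ cl) e v ≡ σ φ e v
    other e∈ = kempe-other φ cl (λ { refl → c∉ e∈ }) (λ { refl → path-colour p e∈ mr })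
    p′ : Path (kempe φ cl) v₀ m₀ cs s c
    p′ = transport p (λ e∈ → other e∈ r) (λ q e∈ _ → trans (other e∈ _) (path-miss q))
      (trans (kempe-off φ cl (pair-out (path-end≢r X p) (path-end≢next X p c∉ refl t≢r)) c)
        (path-miss p))

  -- If a closed set contained `s` but not `r`, swapping `ρ` and `d` on it would make `s` miss `ρ`
  -- while `r` still does. The path up to `s` survives, as its colours are neither `ρ` nor `d`, and
  -- `path-avoids-r` is violated.
  end-linked : ∀ {φ v₀ m₀ cs s d ρ} → Exclusive v₀ → Path φ v₀ m₀ cs s d → d ∉ cs →
    Miss φ r ρ → Linked φ ρ d s r
  end-linked {φ} X (start m) d∉ mr = linked {φ = φ} λ χ cl χs χr →
    no-common X (kempe φ cl) (trans (kempe-off φ cl χr _) mr) (trans (kempe-α φ cl χs) m)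
  end-linked {φ} {d = d} {ρ} X (step {c = c} p c∉ refl t≢r m) d∉ mr = linked {φ = φ} λ χ cl χs χr →
    let other : ∀ {e} → e ∈ _ → ∀ v → σ (kempe φ cl) e v ≡ σ φ e v
        other e∈ = kempe-other φ cl (λ { refl → path-colour p e∈ mr }) (λ { refl → d∉ (there e∈) })
    in path-avoids-r X _ {kempe φ cl}
      (step
        (transport p (λ e∈ → other e∈ r) (λ q e∈ _ → trans (other e∈ _) (path-miss q))
          (trans (kempe-other φ cl (λ { refl → t≢r mr }) (λ { refl → d∉ (here refl) }) _)
            (path-miss p)))
        c∉ (kempe-off φ cl χr c) t≢r (trans (kempe-α φ cl χs) m))
      (trans (kempe-off φ cl χr ρ) mr)

  -- The swap could harm only a path vertex that misses `e` or `ρ`. In the first case the vertex is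
  -- linked to `r`, hence outside `χ`; the second is excluded by `path-avoids-r`.
  stable : ∀ {φ v₀ m₀ cs s d ρ e χ} → Exclusive v₀ → Path φ v₀ m₀ cs s d → d ∉ cs →
    Miss φ r ρ → (cl : Closed φ ρ e χ) → χ r ≡ false → Path (kempe φ cl) v₀ m₀ cs s d
  stable {φ} {v₀} {m₀} {ρ = ρ} {e} {χ} X p d∉ mr cl χr =
    transport p (λ _ → kempe-off φ cl χr _) (λ q _ f∉ → keep q f∉) (keep p d∉)
    where
    keep : ∀ {cs′ v f} → Path φ v₀ m₀ cs′ v f → f ∉ cs′ → Miss (kempe φ cl) v f
    keep {v = v} {f} q f∉ with f ≟ e
    ... | yes refl =
      trans (kempe-off φ cl (trans (end-linked X q f∉ mr χ cl) χr) f) (path-miss q)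
    ... | no f≢e =
      trans (kempe-other φ cl (λ { refl → path-avoids-r X _ q mr }) f≢e v) (path-miss q)

  -- An earlier vertex `v` missing `d` is linked to `r`, so the `ρ`/`d` chain of `t` avoids both.
  -- Swapping there keeps the path and makes `t` miss `ρ`, as `r` does.
  no-revisit : ∀ {φ v₀ m₀ cs s c t d ρ} → Exclusive v₀ → Path φ v₀ m₀ cs s c → c ∉ cs →
    σ φ c r ≡ t → t ≢ r → Miss φ t d → Miss φ r ρ → d ∉ c ∷ cs
  no-revisit {φ} X p c∉ eq t≢r mt mr (here refl) =
    t≢r (trans (≡-sym mt) (σ-swap φ eq))
  no-revisit {φ} {c = c} X p c∉ eq t≢r mt mr (there d∈) with prefix p d∈
  ... | cs′ , v , q , d∉ , sub =
    separate φ (inj₁ mr) (inj₂ (path-miss q)) (inj₂ mt)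
      (path-end≢r X q ∘ ≡-sym) (t≢r ∘ ≡-sym) (path-end≢next X q (c∉ ∘ sub) eq t≢r)
      (λ χ cl → ≡-sym (end-linked X q d∉ mr χ cl))
      λ χ cl χt χr χv → path-avoids-r X _ {kempe φ cl}
        (step (stable X p c∉ mr cl χr) c∉ (trans (kempe-off φ cl χr c) eq) t≢r
          (trans (kempe-α φ cl χt) mt))
        (trans (kempe-off φ cl χr _) mr)

  -- Both `s` and `s′` are linked to `r` in the colours `ρ` and `d`, but a chain has no three ends.
  end-unique : ∀ {φ v₀ v₀′ m₀ m₀′ cs cs′ s s′ d ρ} → Exclusive v₀ → Exclusive v₀′ →
    Path φ v₀ m₀ cs s d → d ∉ cs → Path φ v₀′ m₀′ cs′ s′ d → d ∉ cs′ → Miss φ r ρ → s ≡ s′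
  end-unique {φ} {s = s} {s′} X X′ p d∉ p′ d∉′ mr = decidable-stable (s ≟ s′) λ s≢s′ →
    separate φ (inj₁ mr) (inj₂ (path-miss p)) (inj₂ (path-miss p′))
      (path-end≢r X p ∘ ≡-sym) (path-end≢r X′ p′ ∘ ≡-sym) s≢s′
      (λ χ cl → ≡-sym (end-linked X p d∉ mr χ cl))
      λ χ cl χs′ χr _ →
        case trans (≡-sym χs′) (trans (end-linked X′ p′ d∉′ mr χ cl) χr) of λ ()

  -- Equal last colours force equal last vertices, hence equal last edges at `r`, and these can be
  -- peeled off. First vertices are not adjacent to `r`, so both paths run out at once, at the same
  -- origin.
  paths-disjoint : ∀ {φ v₀ v₀′ m₀ m₀′ cs cs′ s s′ d ρ} → Exclusive v₀ → Exclusive v₀′ →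
    ¬ (v₀ ≡ v₀′ × m₀ ≡ m₀′) →
    Path φ v₀ m₀ cs s d → d ∉ cs → Path φ v₀′ m₀′ cs′ s′ d → d ∉ cs′ → ¬ Miss φ r ρ
  paths-disjoint X X′ ne p d∉ p′ d∉′ mr with end-unique X X′ p d∉ p′ d∉′ mr
  paths-disjoint X X′ ne (start _) _ (start _) _ mr | refl = ne (refl , refl)
  paths-disjoint {φ} X X′ ne (start _) _ (step _ _ eq t≢r _) _ mr | refl =
    nonadj X (edge-at-r φ eq t≢r)
  paths-disjoint {φ} X X′ ne (step _ _ eq t≢r _) _ (start _) _ mr | refl =
    nonadj X′ (edge-at-r φ eq t≢r)
  paths-disjoint {φ} X X′ ne (step {c = c} p c∉ refl t≢r _) _ (step {c = c′} p′ c∉′ eq′ _ _) _ mr | refl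
    with unique φ c c′ r (≡-sym eq′) t≢r
  ... | refl = paths-disjoint X X′ ne p c∉ p′ c∉′ mr

  -- A full vertex `t` may miss no colour and then cannot end a `Path`, so the path stops at the
  -- vertex before it.
  record Ends (φ : M) (v₀ : V) (m₀ : C) (t : V) : Set where
    constructor ends
    field
      {colours} : List C
      {last}    : V
      {colour}  : C
      path      : Path φ v₀ m₀ colours last colour
      fresh     : colour ∉ colours
      edge-r    : σ φ colour r ≡ t
      ≢r        : t ≢ r

  ends-distinct : ∀ {φ v₀ v₀′ m₀ m₀′ t t′ ρ} → Exclusive v₀ → Exclusive v₀′ →
    ¬ (v₀ ≡ v₀′ × m₀ ≡ m₀′) → Miss φ r ρ → Ends φ v₀ m₀ t → Ends φ v₀′ m₀′ t′ → t ≢ t′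
  ends-distinct {φ} X X′ ne mr (ends p c∉ refl t≢r) (ends p′ c∉′ eq′ _) refl
    with unique φ _ _ r (≡-sym eq′) t≢r
  ... | refl = paths-disjoint X X′ ne p c∉ p′ c∉′ mr

  ends-adj : ∀ {φ v₀ m₀ t} → Ends φ v₀ m₀ t → Adj E r t
  ends-adj {φ} (ends _ _ eq t≢r) = edge-at-r φ eq t≢r

  module _ (Full : V → Set) (full-or-missing : ∀ (φ : M) t → Adj E r t → Full t ⊎ ∃ (Miss φ t)) where

    extend : ∀ fuel {φ v₀ m₀ cs s c ρ} → Exclusive v₀ → Miss φ r ρ →
      Path φ v₀ m₀ cs s c → c ∉ cs → Unique cs → k ≤ length cs + fuel →
      ∃[ t ] Ends φ v₀ m₀ t × Full t
    -- With no fuel left, `c ∷ cs` would consist of more than `k` distinct colours.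
    extend zero {cs = cs} {c = c} X mr p c∉ u k≤ =
      contradiction (ℕ.≤-trans (s≤s (subst (k ≤_) (ℕ.+-identityʳ _) k≤)) bound) (ℕ.<-irrefl refl)
      where
      bound : suc (length cs) ≤ k
      bound = subst (suc (length cs) ≤_) (length-tabulate (λ i → i))
        (injection⇒length≤ (λ e → e) {xs = c ∷ cs} {ys = allFin k}
          (All.tabulate (λ e∈ → λ { refl → c∉ e∈ }) ∷ u) (λ _ _ eq → eq) (λ _ → ∈-allFin _))
    extend (suc fuel) {φ} {cs = cs} {c = c} X mr p c∉ u k≤ with σ φ c r ≟ r
    ... | yes mc = contradiction mc (path-avoids-r X _ p)
    ... | no t≢r with full-or-missing φ (σ φ c r) (edge φ c r t≢r)
    ...   | inj₁ full = σ φ c r , ends p c∉ refl t≢r , full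
    ...   | inj₂ (d , mt) = extend fuel X mr (step p c∉ refl t≢r mt)
            (no-revisit X p c∉ refl t≢r mt mr)
            (All.tabulate (λ e∈ → λ { refl → c∉ e∈ }) ∷ u)
            (subst (k ≤_) (ℕ.+-suc (length cs) fuel) k≤)

    reaches-full : ∀ {φ v₀ m₀ ρ} → Exclusive v₀ → Miss φ r ρ → Miss φ v₀ m₀ →
      ∃[ t ] Ends φ v₀ m₀ t × Full t
    reaches-full X mr m = extend k X mr (start m) (λ ()) [] ℕ.≤-refl

  -- Passing exclusiveness from x to its neighbour y

  module AdjacentVertices {x y : V} (X : Exclusive x)
    (y≢r : y ≢ r) (y-nonadj : ¬ Adj E r y) (xy : Adj E x y) where

    private
      x≢y : x ≢ y
      x≢y = adj⇒≢ E xy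

    next≢x,y : ∀ {φ : M} {c t} → σ φ c r ≡ t → t ≢ r → t ≢ x × t ≢ y
    next≢x,y {φ} eq t≢r =
      (λ { refl → nonadj X (edge-at-r φ eq t≢r) }) , (λ { refl → y-nonadj (edge-at-r φ eq t≢r) })

    -- Otherwise a swap of `a` and `b` on a closed set with `x` but without `s` makes `x` miss `b`.
    -- The path to `s` survives because its colours include neither, and `end-unique` identifies `s`
    -- with `x`.
    start-linked : ∀ {φ a b c cs s ρ} → Miss φ r ρ → a ≢ c → Miss φ x a →
      Path φ x c cs s b → b ∉ cs → s ≢ x → Linked φ a b x s
    start-linked {φ} {a} {b} {c} {cs} {s} {ρ} mr a≢c ma p b∉ s≢x = linked {φ = φ} λ χ cl χx χs →
      let other : ∀ {e} → e ∈ cs → ∀ v → σ (kempe φ cl) e v ≡ σ φ e v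
          other e∈ = kempe-other φ cl (λ { refl → a∉ e∈ }) (λ { refl → b∉ e∈ })
          p′ = transport {φ′ = kempe φ cl} p (λ e∈ → other e∈ r) (λ q e∈ _ → trans (other e∈ _) (path-miss q))
            (trans (kempe-off φ cl χs b) (path-miss p))
      in s≢x (end-unique X X p′ b∉ (start (trans (kempe-β φ cl χx) ma)) (λ ())
        (trans (kempe-other φ cl (λ { refl → no-common X φ mr ma })
          (λ { refl → path-avoids-r X _ p mr }) r) mr))
      where
      a∉ : a ∉ cs
      a∉ a∈ with prefix p a∈
      ... | _ , _ , q , a∉′ , _ =
        paths-disjoint X X (a≢c ∘ proj₂) (start ma) (λ ()) q a∉′ mr

    -- Successive swaps at y turn the colour of xy into ρ while x and y both come to miss a;
    -- then x may miss ρ as well.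
    no-path-to-xy-colour : ∀ {φ a b c cs s ρ} → Miss φ r ρ → a ≢ c →
      Miss φ x a → Miss φ x c → Miss φ y c → σ φ b x ≡ y →
      Path φ x c cs s b → b ∉ cs → ⊥
    no-path-to-xy-colour {φ} {a} {b} {c} {cs} {s} {ρ} mr a≢c xa xc yc xy-b p b∉ =
      separate φ (inj₁ mr) (inj₂ xc) (inj₂ yc) r≢x r≢y x≢y
        (λ χ cl → ≡-sym (end-linked X (start {φ} xc) (λ ()) mr χ cl))
        λ χ cl χy χr χx → y-misses-ρ (kempe φ cl)
          (trans (kempe-off φ cl χr ρ) mr) (trans (kempe-off φ cl χx a) xa)
          (trans (kempe-off φ cl χx c) xc) (trans (kempe-off φ cl χx b) xy-b)
          (trans (kempe-α φ cl χy) yc) (stable X p b∉ mr cl χr)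
      where
      r≢x : r ≢ x
      r≢x = ≢r X ∘ ≡-sym
      r≢y : r ≢ y
      r≢y = y≢r ∘ ≡-sym
      s≢x : s ≢ x
      s≢x refl = x≢y (trans (≡-sym (path-miss p)) xy-b)
      s≢y : s ≢ y
      s≢y refl = [ (λ { refl → x≢y refl }) , y-nonadj ]′ (path-end p)
      a≢b : a ≢ b
      a≢b refl = x≢y (trans (≡-sym xa) xy-b)
      a≢ρ : a ≢ ρ
      a≢ρ refl = no-common X φ mr xa
      b≢ρ : b ≢ ρ
      b≢ρ refl = path-avoids-r X _ p mr

      xy-and-a : (φ : M) → Miss φ r ρ → Miss φ x a → Miss φ y a → σ φ ρ x ≡ y → ⊥
      xy-and-a φ mr xa ya xy-ρ =
        no-common X (kempe φ cl) (trans (kempe-off φ cl (pair-out r≢x r≢y) ρ) mr)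
          (trans (kempe-α φ cl (pair-left x y)) xa)
        where
        cl : Closed φ ρ a (pair x y)
        cl = pair-closed φ xy-ρ xa ya

      y-misses-b : (φ : M) → Miss φ r ρ → Miss φ x a → Miss φ y b → σ φ ρ x ≡ y →
        Path φ x c cs s b → ⊥
      y-misses-b φ mr xa yb xy-ρ p =
        separate φ (inj₁ xa) (inj₂ (path-miss p)) (inj₂ yb) (s≢x ∘ ≡-sym) x≢y s≢y
          (start-linked mr a≢c xa p b∉ s≢x)
          λ χ cl χy χx χs → xy-and-a (kempe φ cl)
            (trans (kempe-other φ cl (a≢ρ ∘ ≡-sym) (b≢ρ ∘ ≡-sym) r) mr)
            (trans (kempe-off φ cl χx a) xa) (trans (kempe-α φ cl χy) yb)
            (trans (kempe-off φ cl χx ρ) xy-ρ)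

      y-misses-ρ : (φ : M) → Miss φ r ρ → Miss φ x a → Miss φ x c → σ φ b x ≡ y →
        Miss φ y ρ → Path φ x c cs s b → ⊥
      y-misses-ρ φ mr xa xc xy-b yρ p =
        separate φ (inj₁ mr) (inj₂ (path-miss p)) (inj₁ yρ) (path-end≢r X p ∘ ≡-sym) r≢y s≢y
          (λ χ cl → ≡-sym (end-linked X p b∉ mr χ cl))
          λ χ cl χy χr χs →
            -- The edge `xy` has colour `b`, so `x` lies on the chain of `y` and the swap gives this
            -- edge the colour `ρ`.
            let χx = trans (≡-sym (proj₂ (cl x))) (trans (cong χ xy-b) χy)
            in y-misses-b (kempe φ cl)
              (trans (kempe-off φ cl χr ρ) mr) (trans (kempe-other φ cl a≢ρ a≢b x) xa)
              (trans (kempe-β φ cl χy) yρ) (trans (kempe-α φ cl χx) xy-b)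
              (stable X p b∉ mr cl χr)

    -- The edge `xy` passes from colour `c` to `b`. The auxiliary chain through `y` is not
    -- controlled, so away from `x`, `y` and `r` the colours `ρ` and `b` may move.
    record Recoloured (φ φ′ : M) (ρ b c : C) : Set where
      field
        at-r    : ∀ e → σ φ′ e r ≡ σ φ e r
        at-x    : ∀ {e} → e ≢ b → e ≢ c → σ φ′ e x ≡ σ φ e x
        off-x,y : ∀ {t e} → t ≢ x → t ≢ y → e ≢ ρ → e ≢ b → σ φ′ e t ≡ σ φ e t
        x-miss  : Miss φ′ x c
        y-miss  : Miss φ′ y c
        xy-b    : σ φ′ b x ≡ y
        keeps   : ∀ {m cs s d} → m ≢ b → Path φ x m cs s d → d ∉ cs → Path φ′ x m cs s d

    -- The `ρ`/`b` chain of `y` avoids `r` and `x`, which are linked. Swapping on it makes `y` miss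
    -- `b`; then both ends of `xy` miss `b` and the edge can take that colour.
    recolour-xy : ∀ φ {ρ b c} → Miss φ r ρ → Miss φ y ρ → Miss φ x b → σ φ c x ≡ y →
      ¬ ¬ (∃ λ φ′ → Recoloured φ φ′ ρ b c)
    recolour-xy φ {ρ} {b} {c} mr yρ xb xy-c κ =
      separate φ (inj₁ mr) (inj₂ xb) (inj₁ yρ) r≢x r≢y x≢y
        (λ χ cl → ≡-sym (end-linked X (start {φ} xb) (λ ()) mr χ cl)) body
      where
      r≢x : r ≢ x
      r≢x = ≢r X ∘ ≡-sym
      r≢y : r ≢ y
      r≢y = y≢r ∘ ≡-sym
      body : ∀ χ → Closed φ ρ b χ → χ y ≡ true → χ r ≡ false → χ x ≡ false → ⊥
      body χ cl χy χr χx = κ (φ₂ , record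
        { at-r = λ e → trans (off₂ r≢x r≢y e) (kempe-off φ cl χr e)
        ; at-x = λ e≢b e≢c → trans (kempe-other φ₁ cl₂ e≢c e≢b x) (kempe-off φ cl χx _)
        ; off-x,y = λ t≢x t≢y e≢ρ e≢b → trans (off₂ t≢x t≢y _) (kempe-other φ cl e≢ρ e≢b _)
        ; x-miss = trans (kempe-α φ₁ cl₂ (pair-left x y)) xb₁
        ; y-miss = trans (kempe-α φ₁ cl₂ (pair-right x y)) yb₁
        ; xy-b = trans (kempe-β φ₁ cl₂ (pair-left x y)) xy-c₁
        ; keeps = λ m≢b p d∉ → let p₁ = stable X p d∉ mr cl χr in
            transport p₁ (λ _ → off₂ r≢x r≢y _) (λ q _ _ → keep m≢b q) (keep m≢b p₁)
        })
        where
        φ₁ = kempe φ cl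
        xb₁ : Miss φ₁ x b
        xb₁ = trans (kempe-off φ cl χx b) xb
        yb₁ : Miss φ₁ y b
        yb₁ = trans (kempe-β φ cl χy) yρ
        xy-c₁ : σ φ₁ c x ≡ y
        xy-c₁ = trans (kempe-off φ cl χx c) xy-c
        cl₂ : Closed φ₁ c b (pair x y)
        cl₂ = pair-closed φ₁ xy-c₁ xb₁ yb₁
        φ₂ = kempe φ₁ cl₂
        off₂ : ∀ {t} → t ≢ x → t ≢ y → ∀ e → σ φ₂ e t ≡ σ φ₁ e t
        off₂ t≢x t≢y = kempe-off φ₁ cl₂ (pair-out t≢x t≢y)
        keep : ∀ {m cs s d} → m ≢ b → Path φ₁ x m cs s d → Miss φ₂ s d
        keep m≢b (start m) =
          trans (kempe-other φ₁ cl₂ (λ { refl → x≢y (trans (≡-sym m) xy-c₁) }) m≢b x) m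
        keep m≢b (step _ _ eq t≢r m) with next≢x,y {φ₁} eq t≢r
        ... | t≢x , t≢y = trans (off₂ t≢x t≢y _) m

    module _ (Full : V → Set)
      (full-or-missing : ∀ (φ : M) t → Adj E r t → Full t ⊎ ∃ (Miss φ t))
      (two-full : ∀ {t₁ t₂ t₃} → Adj E r t₁ → Adj E r t₂ → Adj E r t₃ →
        Full t₁ → Full t₂ → Full t₃ → t₁ ≢ t₂ → t₁ ≢ t₃ → t₂ ≢ t₃ → ⊥)
      (two-missing : ∀ (φ : M) → ∃₂ λ a b → a ≢ b × Miss φ x a × Miss φ x b) where

      -- If xy has colour c, recolouring xy by a or by b frees c at x. The path from c is then the
      -- same in both colourings, so its end differs from those of the paths from a and from b.
      neighbour-exclusive : Exclusive y
      neighbour-exclusive = record { ≢r = y≢r ; nonadj = y-nonadj ; no-common = no-common-y }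
        where
        no-common-y : ∀ (φ : M) {ρ} → Miss φ r ρ → Miss φ y ρ → ⊥
        no-common-y φ {ρ} mr yρ with two-missing φ | cover φ x y xy
        ... | a , b , a≢b , xa , xb | c , xy-c =
          recolour-xy φ mr yρ xb xy-c λ { (φᵇ , R) →
          recolour-xy φ mr yρ xa xy-c λ { (φᵃ , S) → compare φᵇ R φᵃ S } }
          where
          a≢c : a ≢ c
          a≢c refl = x≢y (trans (≡-sym xa) xy-c)
          b≢c : b ≢ c
          b≢c refl = x≢y (trans (≡-sym xb) xy-c)
          compare : ∀ φᵇ → Recoloured φ φᵇ ρ b c → ∀ φᵃ → Recoloured φ φᵃ ρ a c → ⊥
          compare φᵇ R φᵃ S
            with reaches-full Full full-or-missing {φ} X mr xa
               | reaches-full Full full-or-missing {φ} X mr xb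
               | reaches-full Full full-or-missing {φᵇ} X (trans (Recoloured.at-r R ρ) mr)
                   (Recoloured.x-miss R)
          ... | tᵃ , endᵃ@(ends pᵃ fᵃ eqᵃ neᵃ) , fullᵃ
              | tᵇ , endᵇ@(ends pᵇ fᵇ eqᵇ neᵇ) , fullᵇ
              | tᶜ , endᶜ@(ends {cs} {s} {e} pᶜ fᶜ eqᶜ neᶜ) , fullᶜ =
            -- The ends from `a` and `b` are compared in `φ`, those from `a` and `c` in `φᵇ`, and
            -- those from `b` and `c` in `φᵃ`.
            two-full (ends-adj endᵃ) (ends-adj endᵇ) (ends-adj endᶜ) fullᵃ fullᵇ fullᶜ
              (ends-distinct X X (a≢b ∘ proj₂) mr endᵃ endᵇ)
              (ends-distinct X X (a≢c ∘ proj₂) mrᵇ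
                (ends (R.keeps a≢b pᵃ fᵃ) fᵃ (trans (R.at-r _) eqᵃ) neᵃ) endᶜ)
              (ends-distinct X X (b≢c ∘ proj₂) mrᵃ
                (ends (S.keeps (a≢b ∘ ≡-sym) pᵇ fᵇ) fᵇ (trans (S.at-r _) eqᵇ) neᵇ)
                (ends p′ fᶜ (trans (same-r e) eqᶜ) neᶜ))
            where
            module R = Recoloured R
            module S = Recoloured S
            mrᵇ : Miss φᵇ r ρ
            mrᵇ = trans (R.at-r ρ) mr
            mrᵃ : Miss φᵃ r ρ
            mrᵃ = trans (S.at-r ρ) mr
            same-r : ∀ f → σ φᵃ f r ≡ σ φᵇ f r
            same-r f = trans (S.at-r f) (≡-sym (R.at-r f))
            xaᵇ : Miss φᵇ x a
            xaᵇ = trans (R.at-x a≢b a≢c) xa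
            -- Away from `x` and `y`, the colourings `φᵃ` and `φᵇ` can differ only in `ρ`, `a` and
            -- `b`, and the path from `c` meets none of these.
            keep : ∀ {cs′ v f} → Path φᵇ x c cs′ v f → f ∉ cs′ → Miss φᵃ v f
            keep (start _) _ = S.x-miss
            keep {f = f} q@(step _ _ eq t≢r m) f∉ with next≢x,y {φᵇ} eq t≢r
            ... | t≢x , t≢y =
              trans (S.off-x,y t≢x t≢y f≢ρ f≢a) (trans (≡-sym (R.off-x,y t≢x t≢y f≢ρ f≢b)) m)
              where
              f≢ρ : f ≢ ρ
              f≢ρ refl = path-avoids-r X _ q mrᵇ
              f≢a : f ≢ a
              f≢a refl = paths-disjoint X X (a≢c ∘ proj₂) (start xaᵇ) (λ ()) q f∉ mrᵇ
              f≢b : f ≢ b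
              f≢b refl = no-path-to-xy-colour mrᵇ a≢c xaᵇ R.x-miss R.y-miss R.xy-b q f∉
            p′ : Path φᵃ x c cs s e
            p′ = transport pᶜ (λ _ → same-r _) (λ q _ → keep q) (keep pᶜ fᶜ)

-- Edge deletion and degree counts

∧-true : ∀ {a b} → a ∧ b ≡ true → a ≡ true × b ≡ true
∧-true {true} {true} _ = refl , refl

true-∧ : ∀ {a b} → a ≡ true → b ≡ true → a ∧ b ≡ true
true-∧ refl refl = refl

module _ {n : ℕ} where

  SameEdge : (a b u v : Fin n) → Set
  SameEdge a b u v = (u ≡ a × v ≡ b) ⊎ (u ≡ b × v ≡ a)

  same-edge? : ∀ a b u v → Dec (SameEdge a b u v)
  same-edge? a b u v = (u ≟ a ×-dec v ≟ b) ⊎-dec (u ≟ b ×-dec v ≟ a)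

  same-edge-swap : ∀ {a b u v} → SameEdge a b u v → SameEdge a b v u
  same-edge-swap (inj₁ (p , q)) = inj₂ (q , p)
  same-edge-swap (inj₂ (p , q)) = inj₁ (q , p)

  delete : Graph n → Fin n → Fin n → Graph n
  delete H a b = record
    { adj = λ u v → adj H u v ∧ not (does (same-edge? a b u v))
    ; sym = λ u v → cong₂ (λ p q → p ∧ not q) (Graph.sym H u v)
        (does-⇔ (mk⇔ same-edge-swap same-edge-swap) (same-edge? a b u v) (same-edge? a b v u))
    ; irrefl = λ v → cong (_∧ not (does (same-edge? a b v v))) (irrefl H v)
    }

  module _ (H : Graph n) {a b u v : Fin n} where

    delete-⊆ : Adj (delete H a b) u v → Adj H u v
    delete-⊆ = proj₁ ∘ ∧-true

    delete-∌ : Adj (delete H a b) u v → ¬ SameEdge a b u v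
    delete-∌ e same with trans (≡-sym (proj₂ (∧-true {adj H u v} e)))
                           (cong not (dec-true (same-edge? a b u v) same))
    ... | ()

    delete-keep : Adj H u v → ¬ SameEdge a b u v → Adj (delete H a b) u v
    delete-keep e other = true-∧ e (cong not (dec-false (same-edge? a b u v) other))

  _⊑_ : Graph n → Graph n → Set
  H ⊑ G = ∀ {u v} → Adj H u v → Adj G u v

  delete-mono : ∀ {H G : Graph n} {a b} → H ⊑ G → delete H a b ⊑ delete G a b
  delete-mono {H} {G} H⊑G e = delete-keep G (H⊑G (delete-⊆ H e)) (delete-∌ H e)

  colourable-mono : ∀ {k} {H G : Graph n} → H ⊑ G → EdgeColourable G k → EdgeColourable H k
  colourable-mono H⊑G c = record
    { colour = colour ; csym = csym ; proper = λ u v w uv uw → proper u v w (H⊑G uv) (H⊑G uw) }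
    where open ProperEdgeColouring c

  trues : (Fin n → Bool) → List (Fin n)
  trues p = filter (λ u → p u Bool.≟ true) (allFin n)

  length≤countB : ∀ (p : Fin n → Bool) {vs} → Unique vs → (∀ {v} → v ∈ vs → p v ≡ true) →
    length vs ≤ countB p
  length≤countB p u all-true = injection⇒length≤ (λ v → v) u (λ _ _ eq → eq)
    λ {v} v∈ → ∈-filter⁺ (λ u → p u Bool.≟ true) (∈-allFin v) (all-true v∈)

  ∈-trues⁻ : ∀ (p : Fin n → Bool) {v} → v ∈ trues p → p v ≡ true
  ∈-trues⁻ p v∈ = proj₂ (∈-filter⁻ (λ u → p u Bool.≟ true) {xs = allFin n} v∈)

  trues-unique : ∀ p → Unique (trues p)
  trues-unique p = filter⁺ (λ u → p u Bool.≟ true) (allFin⁺ n)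

  countB-mono : ∀ (p q : Fin n → Bool) → (∀ {v} → p v ≡ true → q v ≡ true) → countB p ≤ countB q
  countB-mono p q p⇒q = length≤countB q (trues-unique p) (p⇒q ∘ ∈-trues⁻ p)

  countB-strict : ∀ (p q : Fin n → Bool) {w} → (∀ {v} → p v ≡ true → q v ≡ true) →
    q w ≡ true → p w ≢ true → countB p < countB q
  countB-strict p q {w} p⇒q qw ¬pw =
    length≤countB q (All.tabulate (λ v∈ → λ { refl → ¬pw (∈-trues⁻ p v∈) }) ∷ trues-unique p)
      λ { (here refl) → qw ; (there v∈) → p⇒q (∈-trues⁻ p v∈) }

  deg-delete : ∀ (H : Graph n) {a b u v} → Adj H u v → SameEdge a b u v →
    deg (delete H a b) u < deg H u
  deg-delete H {a} {b} {u} uv same = countB-strict (adj (delete H a b) u) (adj H u) (delete-⊆ H) uv (λ e → delete-∌ H e same)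

-- Missing colours and the passage between the two forms of colouring

module _ {n k : ℕ} {E : Graph n} where

  toColouring : EdgeColourable E k → Colouring E k
  toColouring c = record
    { σ = τ
    ; involutive = inv
    ; edge = λ α v ne → [ ⊥-elim ∘ ne , proj₁ ]′ (τ-spec α v)
    ; cover = λ u v uv → colour u v , τ-edge uv refl
    ; unique = uniq
    }
    where
    open ProperEdgeColouring c
    coloured? : ∀ α v → Dec (∃ λ u → Adj E v u × colour v u ≡ α)
    coloured? α v = any? λ u → adj E v u Bool.≟ true ×-dec colour v u ≟ α
    τ : Fin k → Fin n → Fin n
    τ α v with coloured? α v
    ... | yes (u , _) = u
    ... | no _ = v
    τ-spec : ∀ α v → τ α v ≡ v ⊎ Adj E v (τ α v) × colour v (τ α v) ≡ α
    τ-spec α v with coloured? α v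
    ... | yes (u , p) = inj₂ p
    ... | no _ = inj₁ refl
    τ-edge : ∀ {α v u} → Adj E v u → colour v u ≡ α → τ α v ≡ u
    τ-edge {α} {v} {u} vu eq with coloured? α v
    ... | yes (w , vw , eq′) = decidable-stable (w ≟ u) λ w≢u →
      proper v w u vw vu w≢u (trans eq′ (≡-sym eq))
    ... | no none = contradiction (u , vu , eq) none
    inv : ∀ α v → τ α (τ α v) ≡ v
    inv α v with τ-spec α v
    ... | inj₁ eq = trans (cong (τ α) eq) eq
    ... | inj₂ (e , eq) = τ-edge (adj-sym E e) (trans (csym (τ α v) v) eq)
    uniq : ∀ α β v → τ α v ≡ τ β v → τ α v ≢ v → α ≡ β
    uniq α β v eq ne with τ-spec α v | τ-spec β v
    ... | inj₁ eq′ | _ = contradiction eq′ ne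
    ... | inj₂ _ | inj₁ eq′ = contradiction (trans eq eq′) ne
    ... | inj₂ (_ , p) | inj₂ (_ , q) = trans (≡-sym p) (trans (cong (colour v) eq) q)

  missing : Colouring E k → Fin n → List (Fin k)
  missing φ v = filter (λ α → σ φ α v ≟ v) (allFin k)

  ∈-missing⁻ : ∀ φ {v α} → α ∈ missing φ v → Miss φ v α
  ∈-missing⁻ φ {v} α∈ = proj₂ (∈-filter⁻ (λ α → σ φ α v ≟ v) {xs = allFin k} α∈)

  missing-unique : ∀ φ v → Unique (missing φ v)
  missing-unique φ v = filter⁺ (λ α → σ φ α v ≟ v) (allFin⁺ k)

  -- A colour is sent to itself if `v` misses it, and otherwise to the neighbour it leads to.
  k≤missing+deg : ∀ φ v → k ≤ length (missing φ v) + deg E v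
  k≤missing+deg φ v = begin
    k                                           ≡⟨ ≡-sym (length-tabulate (λ i → i)) ⟩
    length (allFin k)                           ≤⟨ injection⇒length≤ f (allFin⁺ k) (λ _ _ → inj)
                                                     (λ _ → into) ⟩
    length (map inj₁ Ms ++ map inj₂ Ns)         ≡⟨ length-++ (map inj₁ Ms) ⟩
    length (map inj₁ Ms) + length (map inj₂ Ns) ≡⟨ cong₂ _+_ (length-map inj₁ Ms) (length-map inj₂ Ns) ⟩
    length Ms + length Ns                       ∎
    where
    open ℕ.≤-Reasoning
    Ms = missing φ v
    Ns = trues (adj E v)
    f : Fin k → Fin k ⊎ Fin n
    f α with σ φ α v ≟ v
    ... | yes _ = inj₁ α
    ... | no _ = inj₂ (σ φ α v)
    inj : ∀ {α β} → f α ≡ f β → α ≡ β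
    inj {α} {β} eq with σ φ α v ≟ v | σ φ β v ≟ v
    ... | yes _ | yes _ = inj₁-injective eq
    ... | no ne | no _ = unique φ α β v (inj₂-injective eq) ne
    inj () | yes _ | no _
    inj () | no _ | yes _
    into : ∀ {α} → f α ∈ map inj₁ Ms ++ map inj₂ Ns
    into {α} with σ φ α v ≟ v
    ... | yes m = ∈-++⁺ˡ (∈-map⁺ inj₁ (∈-filter⁺ (λ α → σ φ α v ≟ v) (∈-allFin α) m))
    ... | no ne = ∈-++⁺ʳ (map inj₁ Ms) (∈-map⁺ inj₂
      (∈-filter⁺ (λ u → adj E v u Bool.≟ true) (∈-allFin _) (edge φ α v ne)))

  missing-colour : ∀ φ v → deg E v < k → ∃ (Miss φ v)
  missing-colour φ v d<k with missing φ v | k≤missing+deg φ v | ∈-missing⁻ φ {v}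
  ... | [] | k≤ | _ = contradiction d<k (ℕ.≤⇒≯ k≤)
  ... | α ∷ _ | _ | mem = α , mem (here refl)

  two-missing-colours : ∀ φ v → suc (deg E v) < k → ∃₂ λ a b → a ≢ b × Miss φ v a × Miss φ v b
  two-missing-colours φ v d<k
    with missing φ v | k≤missing+deg φ v | ∈-missing⁻ φ {v} | missing-unique φ v
  ... | [] | k≤ | _ | _ = contradiction (ℕ.<⇒≤ d<k) (ℕ.≤⇒≯ k≤)
  ... | _ ∷ [] | k≤ | _ | _ = contradiction d<k (ℕ.≤⇒≯ k≤)
  ... | a ∷ b ∷ _ | _ | mem | (a≢b ∷ _) ∷ _ = a , b , a≢b , mem (here refl) , mem (there (here refl))

insert-edge : ∀ {n k} (H : Graph n) {r x} (φ : Colouring (delete H r x) k) {ρ} →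
  Miss φ r ρ → Miss φ x ρ → EdgeColourable H k
insert-edge {n} {k} H {r} {x} φ {ρ} mr mx = record { colour = col ; csym = col-sym ; proper = col-proper }
  where
  E = delete H r x
  colour-of : ∀ u v → Dec (SameEdge r x u v) → Dec (Adj E u v) → Fin k
  colour-of u v (yes _) _ = ρ
  colour-of u v (no _) (yes uv) = proj₁ (cover φ u v uv)
  -- On non-edges any value symmetric in `u` and `v` will do.
  colour-of u v (no _) (no _) = ρ
  col : Fin n → Fin n → Fin k
  col u v = colour-of u v (same-edge? r x u v) (adj E u v Bool.≟ true)
  col-sym : ∀ u v → col u v ≡ col v u
  col-sym u v with same-edge? r x u v | same-edge? r x v u
                 | adj E u v Bool.≟ true | adj E v u Bool.≟ true
  ... | yes _ | yes _ | _ | _ = refl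
  ... | yes p | no ¬p | _ | _ = contradiction (same-edge-swap p) ¬p
  ... | no ¬p | yes p | _ | _ = contradiction (same-edge-swap p) ¬p
  ... | no _ | no _ | no _ | no _ = refl
  ... | no _ | no _ | yes uv | no ¬vu = contradiction (adj-sym E uv) ¬vu
  ... | no _ | no _ | no ¬uv | yes vu = contradiction (adj-sym E vu) ¬uv
  ... | no _ | no _ | yes uv | yes vu with cover φ u v uv | cover φ v u vu
  ...   | α , eq | β , eq′ = unique φ α β u (trans eq (≡-sym (σ-swap φ eq′)))
    (λ m → adj⇒≢ E uv (trans (≡-sym m) eq))
  col-edge : ∀ {u v} → Adj H u v → ¬ SameEdge r x u v → σ φ (col u v) u ≡ v
  col-edge {u} {v} uv other with same-edge? r x u v | adj E u v Bool.≟ true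
  ... | yes same | _ = contradiction same other
  ... | no _ | yes e = proj₂ (cover φ u v e)
  ... | no _ | no ¬e = contradiction (delete-keep H uv other) ¬e
  col-same : ∀ {u v} → SameEdge r x u v → col u v ≡ ρ
  col-same {u} {v} same with same-edge? r x u v
  ... | yes _ = refl
  ... | no ¬same = contradiction same ¬same
  ρ-missing : ∀ {u v} → SameEdge r x u v → Miss φ u ρ
  ρ-missing (inj₁ (refl , _)) = mr
  ρ-missing (inj₂ (refl , _)) = mx
  both : ∀ {u v w} → u ≢ v → SameEdge r x u v → SameEdge r x u w → v ≡ w
  both _ (inj₁ (refl , refl)) (inj₁ (_ , refl)) = refl
  both u≢v (inj₁ (refl , refl)) (inj₂ (refl , _)) = contradiction refl u≢v
  both u≢v (inj₂ (refl , refl)) (inj₁ (refl , _)) = contradiction refl u≢v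
  both _ (inj₂ (refl , refl)) (inj₂ (_ , refl)) = refl
  clash : ∀ {u v w} → Adj H u w → SameEdge r x u v → ¬ SameEdge r x u w → col u v ≢ col u w
  clash {u} uw same other eq = adj⇒≢ H uw
    (trans (≡-sym (ρ-missing same))
      (trans (cong (λ α → σ φ α u) (trans (≡-sym (col-same same)) eq)) (col-edge uw other)))
  col-proper : ∀ u v w → Adj H u v → Adj H u w → v ≢ w → col u v ≢ col u w
  col-proper u v w uv uw v≢w eq = by-cases (same-edge? r x u v) (same-edge? r x u w)
    where
    by-cases : Dec (SameEdge r x u v) → Dec (SameEdge r x u w) → ⊥
    by-cases (yes p) (yes q) = v≢w (both (adj⇒≢ H uv) p q)
    by-cases (yes p) (no q) = clash uw p q eq
    by-cases (no p) (yes q) = clash uv q p (≡-sym eq)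
    by-cases (no p) (no q) = v≢w (trans (≡-sym (col-edge uv p))
      (trans (cong (λ α → σ φ α u) eq) (col-edge uw q)))

≡⇒≡ᵇ-true : ∀ {m n} → m ≡ n → (m ≡ᵇ n) ≡ true
≡⇒≡ᵇ-true {m} {n} eq = Equivalence.to T-≡ (ℕ.≡⇒≡ᵇ m n eq)

≡ᵇ-true⇒≡ : ∀ {m n} → (m ≡ᵇ n) ≡ true → m ≡ n
≡ᵇ-true⇒≡ {m} {n} eq = ℕ.≡ᵇ⇒≡ m n (Equivalence.from T-≡ eq)

-- Vizing's adjacency lemma

module UncolourableEdge {n k : ℕ} (H : Graph n) {r x : Fin n} (rx : Adj H r x)
  (deg≤k : ∀ v → deg H v ≤ k) (uncolourable : ¬ EdgeColourable H k) where

  E : Graph n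
  E = delete H r x

  open Fans k E r public

  Full : Fin n → Set
  Full t = deg H t ≡ k

  x-exclusive : Exclusive x
  x-exclusive = record
    { ≢r = adj⇒≢ H rx ∘ ≡-sym
    ; nonadj = λ e → delete-∌ H e (inj₁ (refl , refl))
    ; no-common = λ φ mr mx → uncolourable (insert-edge H φ mr mx)
    }

  r-missing : ∀ (φ : Colouring E k) → ∃ (Miss φ r)
  r-missing φ = missing-colour φ r (ℕ.<-≤-trans (deg-delete H rx (inj₁ (refl , refl))) (deg≤k r))

  deg-x : deg E x < deg H x
  deg-x = deg-delete H (adj-sym H rx) (inj₂ (refl , refl))

  deg-E≤ : ∀ v → deg E v ≤ deg H v
  deg-E≤ v = countB-mono (adj E v) (adj H v) (delete-⊆ H)

  full-or-missing : ∀ (φ : Colouring E k) t → Adj E r t → Full t ⊎ ∃ (Miss φ t)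
  full-or-missing φ t _ with deg H t ℕ.≟ k
  ... | yes full = inj₁ full
  ... | no ne = inj₂ (missing-colour φ t (ℕ.≤-<-trans (deg-E≤ t) (ℕ.≤∧≢⇒< (deg≤k t) ne)))

  fullNbr : Fin n → Bool
  fullNbr u = adj E r u ∧ (deg H u ≡ᵇ k)

  fullNbr⁻ : ∀ {u} → fullNbr u ≡ true → Adj E r u × Full u
  fullNbr⁻ {u} e = proj₁ (∧-true e) , ≡ᵇ-true⇒≡ (proj₂ (∧-true {adj E r u} e))

  -- Each colour missing at `x` leads to a full neighbour of `r` of its own. Adjacency in `fullNbr`
  -- is that of `E`, so `x` is not counted.
  vizing-adjacency : Colouring E k → k < deg H x + countB fullNbr
  vizing-adjacency φ with r-missing φ
  ... | ρ , mr = begin-strict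
    k                                   ≤⟨ k≤missing+deg φ x ⟩
    length (missing φ x) + deg E x      ≤⟨ ℕ.+-monoˡ-≤ (deg E x) ends≤ ⟩
    countB fullNbr + deg E x            <⟨ ℕ.+-monoʳ-< (countB fullNbr) deg-x ⟩
    countB fullNbr + deg H x            ≡⟨ ℕ.+-comm (countB fullNbr) (deg H x) ⟩
    deg H x + countB fullNbr            ∎
    where
    open ℕ.≤-Reasoning
    end : Fin k → Fin n
    end a with σ φ a x ≟ x
    ... | yes m = proj₁ (reaches-full Full full-or-missing {φ} x-exclusive mr m)
    ... | no _ = x
    end-spec : ∀ {a} → Miss φ x a → Ends φ x a (end a) × Full (end a)
    end-spec {a} m with σ φ a x ≟ x
    ... | yes m = proj₂ (reaches-full Full full-or-missing {φ} x-exclusive mr m)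
    ... | no ne = contradiction m ne
    ends≤ : length (missing φ x) ≤ countB fullNbr
    ends≤ = injection⇒length≤ end (missing-unique φ x)
      (λ {a} {b} a∈ b∈ eq → decidable-stable (a ≟ b) λ a≢b →
        ends-distinct x-exclusive x-exclusive (a≢b ∘ proj₂) mr
          (proj₁ (end-spec (∈-missing⁻ φ a∈))) (proj₁ (end-spec (∈-missing⁻ φ b∈))) eq)
      λ a∈ → let (e , full) = end-spec (∈-missing⁻ φ a∈) in
        ∈-filter⁺ (λ u → fullNbr u Bool.≟ true) (∈-allFin _)
          (true-∧ (ends-adj e) (≡⇒≡ᵇ-true full))

-- Minimal uncolourable subgraphs and criticality

DeletionColourable : ∀ {n} → Graph n → ℕ → Fin n → Fin n → Set
DeletionColourable H k u v = Adj H u v → ¬ ¬ EdgeColourable (delete H u v) k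

-- One pass over all pairs is enough: an edge whose deletion gives a colourable graph keeps this
-- property in every subgraph that contains it.
minimal-uncolourable : ∀ {n k} (G : Graph n) → ¬ EdgeColourable G k →
  ¬ ¬ (∃ λ H → H ⊑ G × (¬ EdgeColourable H k) × (∀ u v → DeletionColourable H k u v))
minimal-uncolourable {n} {k} G ¬G κ = shrink (cartesianProduct (allFin n) (allFin n))
  λ { (H , H⊑G , ¬H , del) →
    κ (H , H⊑G , ¬H , λ u v → del (∈-cartesianProduct⁺ (∈-allFin u) (∈-allFin v))) }
  where
  shrink : ∀ L → ¬ ¬ (∃ λ H → H ⊑ G × (¬ EdgeColourable H k) ×
    (∀ {u v} → (u , v) ∈ L → DeletionColourable H k u v))
  shrink [] κ = κ (G , (λ e → e) , ¬G , λ ())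
  shrink ((u , v) ∷ L) κ = shrink L λ { (H , H⊑G , ¬H , del) →
    ¬¬-excluded-middle {A = EdgeColourable (delete H u v) k} λ
      { (yes c) → κ (H , H⊑G , ¬H , λ { (here refl) _ ¬c → ¬c c ; (there e∈) → del e∈ })
      ; (no ¬c) → κ (delete H u v , H⊑G ∘ delete-⊆ H , ¬c , λ
          { (here refl) e → contradiction (inj₁ (refl , refl)) (delete-∌ H e)
          ; (there e∈) e ¬c′ → del e∈ (delete-⊆ H e) λ c →
              ¬c′ (colourable-mono (delete-mono {H = delete H u v} {G = H} (delete-⊆ H)) c) }) } }

module Critical {n k : ℕ} (G : Graph n) (0<k : 0 < k) (connected : Connected G)
  (deg≤k : ∀ v → deg G v ≤ k) (uncolourable : ¬ EdgeColourable G k)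
  (core : ∀ v → deg G v ≡ k → degΔNbrs G k v ≤ 2) where

  -- Vizing's adjacency lemma forces a minimal uncolourable subgraph to have full degree at each
  -- of its non-isolated vertices, so by connectedness it is all of G.
  module _ (H : Graph n) (H⊑G : H ⊑ G) (¬H : ¬ EdgeColourable H k)
    (del : ∀ u v → DeletionColourable H k u v) where

    deg-H≤ : ∀ v → deg H v ≤ deg G v
    deg-H≤ v = countB-mono (adj H v) (adj G v) H⊑G

    deg-H≤k : ∀ v → deg H v ≤ k
    deg-H≤k v = ℕ.≤-trans (deg-H≤ v) (deg≤k v)

    full-in-G : ∀ {v} → deg H v ≡ k → deg G v ≡ k
    full-in-G {v} eq = ℕ.≤-antisym (deg≤k v) (subst (_≤ deg G v) eq (deg-H≤ v))

    NonIsolated : Fin n → Set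
    NonIsolated v = ∃ (Adj H v)

    -- As `deg H x` is at most `k`, the adjacency lemma leaves a positive number of full neighbours.
    full-neighbour : ∀ {v} → NonIsolated v → ¬ ¬ (∃[ u ] Adj H v u × deg H u ≡ k)
    full-neighbour {v} (x , vx) κ = del v x vx λ c →
      pick (trues fullNbr) (λ {u} → ∈-trues⁻ fullNbr {u})
        (ℕ.+-cancelˡ-< (deg H x) 0 _
          (subst (_< deg H x + countB fullNbr) (≡-sym (ℕ.+-identityʳ _))
            (ℕ.≤-<-trans (deg-H≤k x) (vizing-adjacency (toColouring c)))))
      where
      open UncolourableEdge H vx deg-H≤k ¬H
      pick : ∀ us → (∀ {u} → u ∈ us → fullNbr u ≡ true) → 0 < length us → ⊥
      pick (u ∷ _) mem _ = let (e , full) = fullNbr⁻ (mem (here refl)) in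
        κ (u , delete-⊆ H e , full)

    -- At a full neighbour `u` of `v`, the adjacency lemma needs more than `k ∸ deg H v` full
    -- neighbours besides `v`, while the core allows two in all. If `deg G v` is `k`, then `v` is
    -- one of these two; if not, `deg H v` is at most `k ∸ 2`. Either way the bound fails.
    degree-full : ∀ {v} → NonIsolated v → ¬ (deg H v < deg G v)
    degree-full {v} ni d< = full-neighbour ni λ { (u , vu , full) → at u (adj-sym H vu) full }
      where
      at : ∀ u → Adj H u v → deg H u ≡ k → ⊥
      at u uv full = del u v uv λ c → bound (vizing-adjacency (toColouring c))
        where
        open UncolourableEdge H uv deg-H≤k ¬H
        N = countB fullNbr
        coreNbr : Fin n → Bool
        coreNbr w = adj G u w ∧ (deg G w ≡ᵇ k)
        core-nbr : ∀ {w} → fullNbr w ≡ true → coreNbr w ≡ true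
        core-nbr e = true-∧ (H⊑G (delete-⊆ H (proj₁ (fullNbr⁻ e))))
          (≡⇒≡ᵇ-true (full-in-G (proj₂ (fullNbr⁻ e))))
        N≤2 : N ≤ 2
        N≤2 = ℕ.≤-trans (countB-mono fullNbr coreNbr core-nbr) (core u (full-in-G full))
        v∉ : fullNbr v ≢ true
        v∉ e = delete-∌ H (proj₁ (fullNbr⁻ e)) (inj₁ (refl , refl))
        bound : ¬ (k < deg H v + N)
        bound k< with deg G v ℕ.≟ k
        ... | yes full-v = ℕ.<⇒≱ k< (begin
            deg H v + N     ≤⟨ ℕ.+-monoʳ-≤ (deg H v) N≤1 ⟩
            deg H v + 1     ≡⟨ ℕ.+-comm (deg H v) 1 ⟩
            suc (deg H v)   ≤⟨ d< ⟩
            deg G v         ≤⟨ deg≤k v ⟩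
            k               ∎)
          where
          open ℕ.≤-Reasoning
          N≤1 : N ≤ 1
          N≤1 = ℕ.≤-pred (ℕ.≤-trans
            (countB-strict fullNbr coreNbr core-nbr (true-∧ (H⊑G uv) (≡⇒≡ᵇ-true full-v)) v∉)
            (core u (full-in-G full)))
        ... | no ne = ℕ.<⇒≱ k< (begin
            deg H v + N           ≤⟨ ℕ.+-monoʳ-≤ (deg H v) N≤2 ⟩
            deg H v + 2           ≡⟨ ℕ.+-comm (deg H v) 2 ⟩
            suc (suc (deg H v))   ≤⟨ s≤s d< ⟩
            suc (deg G v)         ≤⟨ ℕ.≤∧≢⇒< (deg≤k v) ne ⟩
            k                     ∎)
          where open ℕ.≤-Reasoning

    edge-in-H : ∀ {v w} → NonIsolated v → Adj G v w → Adj H v w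
    edge-in-H {v} {w} ni vw = decidable-stable (adj H v w Bool.≟ true) λ ¬vw →
      degree-full ni (countB-strict (adj H v) (adj G v) H⊑G vw ¬vw)

    non-isolated-along : ∀ {u v} → NonIsolated u → Walk G u v → NonIsolated v
    non-isolated-along ni here = ni
    non-isolated-along {u} ni (step uw walk) =
      non-isolated-along (u , adj-sym H (edge-in-H ni uw)) walk

    some-edge : ¬ ¬ (∃ NonIsolated)
    some-edge none = ¬H (record
      { colour = λ _ _ → fromℕ< 0<k
      ; csym = λ _ _ → refl
      ; proper = λ u v _ uv → contradiction (u , v , uv) none
      })

    G⊑H : ¬ ¬ (G ⊑ H)
    G⊑H κ = some-edge λ { (u , ni) → κ λ {v} →
      edge-in-H (non-isolated-along ni (connected u v)) }

  edge-critical : ∀ {u v} → Adj G u v → ¬ ¬ EdgeColourable (delete G u v) k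
  edge-critical {u} {v} uv ¬c = minimal-uncolourable G uncolourable λ { (H , H⊑G , ¬H , del) →
    G⊑H H H⊑G ¬H del λ (G⊑H : G ⊑ H) → del u v (G⊑H uv) λ c →
      ¬c (colourable-mono (delete-mono {H = G} {G = H} G⊑H) c) }

-- Core neighbours of adjacent vertices of degree one below the maximum

core-neighbour-shared : ∀ {n} (G : Graph n) {Δ} → 0 < Δ → IsHZGraph G Δ → ∀ {x y r} →
  suc (deg G x) ≡ Δ → suc (deg G y) ≡ Δ → Adj G x y → InNΔ G Δ x r → InNΔ G Δ y r
core-neighbour-shared G {Δ} 0<Δ (connected , ((deg≤Δ , _) , (_ , chromatic)) , core) {x} {y} {r}
  deg-x≡ deg-y≡ xy (xr , deg-r) = decidable-stable (adj G y r Bool.≟ true) not-adjacent , deg-r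
  where
  uncolourable : ¬ EdgeColourable G Δ
  uncolourable c = ℕ.<-irrefl refl (chromatic Δ c)
  rx : Adj G r x
  rx = adj-sym G xr
  open Critical G 0<Δ connected deg≤Δ uncolourable core
  open UncolourableEdge G rx deg≤Δ uncolourable

  y≢r : y ≢ r
  y≢r refl = ℕ.<-irrefl deg-r (subst (deg G y <_) deg-y≡ (ℕ.n<1+n _))

  two-full : ∀ {t₁ t₂ t₃} → Adj E r t₁ → Adj E r t₂ → Adj E r t₃ →
    Full t₁ → Full t₂ → Full t₃ → t₁ ≢ t₂ → t₁ ≢ t₃ → t₂ ≢ t₃ → ⊥
  two-full {t₁} {t₂} {t₃} a₁ a₂ a₃ f₁ f₂ f₃ ≢₁₂ ≢₁₃ ≢₂₃ =
    ℕ.<⇒≱ (ℕ.n<1+n 2) (ℕ.≤-trans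
      (length≤countB (λ t → adj G r t ∧ (deg G t ≡ᵇ Δ)) {vs = t₁ ∷ t₂ ∷ t₃ ∷ []}
        ((≢₁₂ ∷ ≢₁₃ ∷ []) ∷ (≢₂₃ ∷ []) ∷ [] ∷ [])
        λ { (here refl) → core-nbr a₁ f₁ ; (there (here refl)) → core-nbr a₂ f₂
          ; (there (there (here refl))) → core-nbr a₃ f₃ })
      (core r deg-r))
    where
    core-nbr : ∀ {t} → Adj E r t → Full t → adj G r t ∧ (deg G t ≡ᵇ Δ) ≡ true
    core-nbr a f = true-∧ (delete-⊆ G a) (≡⇒≡ᵇ-true f)

  -- Deleting `rx` lowers the degree of `x` to at most `Δ ∸ 2`.
  two-missing : ∀ (φ : Colouring E Δ) → ∃₂ λ a b → a ≢ b × Miss φ x a × Miss φ x b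
  two-missing φ = two-missing-colours φ x (subst (suc (deg E x) <_) deg-x≡ (s≤s deg-x))

  not-adjacent : ¬ ¬ Adj G y r
  not-adjacent ¬yr = edge-critical rx λ c → three-paths (toColouring c)
    where
    y-nonadj : ¬ Adj E r y
    y-nonadj ry = ¬yr (adj-sym G (delete-⊆ G ry))
    E-xy : Adj E x y
    E-xy = delete-keep G xy λ
      { (inj₁ (refl , _)) → adj⇒≢ G rx refl ; (inj₂ (_ , refl)) → y≢r refl }
    y-exclusive : Exclusive y
    y-exclusive = AdjacentVertices.neighbour-exclusive x-exclusive y≢r y-nonadj E-xy
      Full full-or-missing two-full two-missing
    three-paths : Colouring E Δ → ⊥
    three-paths φ with r-missing φ | two-missing φ
      | missing-colour φ y (ℕ.≤-<-trans (deg-E≤ y) (subst (deg G y <_) deg-y≡ (ℕ.n<1+n _)))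
    ... | ρ , mr | a , b , a≢b , xa , xb | m , ym
      with reaches-full Full full-or-missing {φ} x-exclusive mr xa
         | reaches-full Full full-or-missing {φ} x-exclusive mr xb
         | reaches-full Full full-or-missing {φ} y-exclusive mr ym
    ... | _ , end₁ , full₁ | _ , end₂ , full₂ | _ , end₃ , full₃ =
      two-full (ends-adj end₁) (ends-adj end₂) (ends-adj end₃) full₁ full₂ full₃
        (ends-distinct x-exclusive x-exclusive (a≢b ∘ proj₂) mr end₁ end₂)
        (ends-distinct x-exclusive y-exclusive (adj⇒≢ G xy ∘ proj₁) mr end₁ end₃)
        (ends-distinct x-exclusive y-exclusive (adj⇒≢ G xy ∘ proj₁) mr end₂ end₃)

theorem2p4 : {n : ℕ} (G : Graph n) (Δ : ℕ) → 4 ≤ Δ → IsHZGraph G Δ →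
    (x y : Fin n) → deg G x ≡ Δ ∸ 1 → deg G y ≡ Δ ∸ 1 → Adj G x y →
    (u : Fin n) → InNΔ G Δ x u ⇔ InNΔ G Δ y u
theorem2p4 G (suc Δ) _ hz x y deg-x deg-y xy u = mk⇔
  (core-neighbour-shared G (s≤s z≤n) hz (cong suc deg-x) (cong suc deg-y) xy)
  (core-neighbour-shared G (s≤s z≤n) hz (cong suc deg-y) (cong suc deg-x) (adj-sym G xy))
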